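{- Let $G$ and $H$ be two graphs on $n$ vertices with diameter $2$. Then $G$ and $H$ have the same $2$-neighborhood degree list if and only if $G$ can be transformed into $H$ by a sequence of degree restricted $2$-switches.
   Context: The graphs $G$ and $H$ are on the same vertex set. The degree $\deg(v)$ of a vertex $v$ is the number of edges incident to $v$. The distance $d(u,v)$ between vertices $u$ and $v$ is the length of a shortest path between them, and the diameter of a graph is the maximum of $d(u,v)$ over all pairs of vertices $u$ and $v$. For a vertex $v$, $N_2(v)$ is the set of vertices at distance $2$ from $v$, and the $2$-neighborhood degree list of $v$, denoted $N_2DL(v)$, is the list of degrees of the vertices in $N_2(v)$, written in descending order. The $2$-neighborhood degree list of a graph $G$ with vertices $v_1,\dots,v_n$, denoted $N_2DL(G)$, is the list of lists $\{N_2DL(v_1), N_2DL(v_2), \dots, N_2DL(v_n)\}$, that is, a listing of $N_2DL(v)$ for every vertex $v$. A $2$-switch in a graph is the replacement of a pair of edges $v_1v_2$ and $w_1w_2$ by the edges $v_1w_2$ and $v_2w_1$, given that $v_1w_2$ and $v_2w_1$ did not appear in the graph originally; there may or may not be edges between the pairs of vertices $v_1,w_1$ and $v_2,w_2$. A degree restricted $2$-switch on edges $v_1v_2$ and $w_1w_2$ is a $2$-switch performed when $\deg(v_1)=\deg(w_1)$ and $\deg(v_2)=\deg(w_2)$. -}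

module Defs where

open import Level using (0ℓ)
open import Data.Nat.Base using (ℕ; zero; suc; _≤_; z≤n; s≤s)
open import Data.Nat.Properties using (≤-decTotalOrder)
open import Data.Fin.Base using (Fin)
open import Data.Fin.Properties using (_≟_; any?)
open import Data.List.Base using (List; []; _∷_; length; map; filter; allFin)
open import Data.List.Relation.Unary.All using ([]; _∷_)
open import Data.List.Relation.Unary.AllPairs using ([]; _∷_)
open import Data.List.Relation.Unary.Unique.Propositional using (Unique)
import Data.List.Sort as Sort
open import Data.Vec.Base using (Vec; tabulate)
open import Data.Product.Base using (Σ-syntax; ∃-syntax; _×_; _,_)
open import Data.Sum.Base using (_⊎_)
open import Data.Empty using (⊥-elim)
open import Function.Bundles using (_⇔_)
open import Relation.Nullary.Negation using (¬_)
open import Relation.Nullary.Decidable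
  using (Dec; _×-dec_; ¬?; map′)
open import Relation.Binary.Core using (Rel)
open import Relation.Binary.Definitions using (Irreflexive; Symmetric; Decidable)
open import Relation.Binary.PropositionalEquality.Core using (_≡_; _≢_; refl)
open import Relation.Binary.Construct.Closure.ReflexiveTransitive using (Star)
import Relation.Binary.Construct.Flip.EqAndOrd as Flip

record Graph (n : ℕ) : Set₁ where
  infix 4 _~_ _~?_
  field
    _~_      : Rel (Fin n) 0ℓ
    ~-irrefl : Irreflexive _≡_ _~_
    ~-sym    : Symmetric _~_
    _~?_     : Decidable _~_

-- Two graphs on the same vertex set are the same when they have the same
-- edges. Propositional equality of records would be too fine, since it also
-- compares the edge types and the proofs stored in the fields.
infix 4 _≈_
_≈_ : ∀ {n} → Graph n → Graph n → Set
G ≈ H = ∀ x y → Graph._~_ G x y ⇔ Graph._~_ H x y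

sort↓ : List ℕ → List ℕ
sort↓ = Sort.sort (Flip.decTotalOrder ≤-decTotalOrder)

module _ {n : ℕ} (G : Graph n) where
  open Graph G

  data Walk : Fin n → Fin n → ℕ → Set where
    []  : ∀ {u} → Walk u u zero
    _∷_ : ∀ {u v w k} → u ~ v → Walk v w k → Walk u w (suc k)

  vertices : ∀ {u v k} → Walk u v k → List (Fin n)
  vertices {u} []      = u ∷ []
  vertices {u} (_ ∷ p) = u ∷ vertices p

  Path : Fin n → Fin n → ℕ → Set
  Path u v k = Σ[ p ∈ Walk u v k ] Unique (vertices p)

  -- d(u,v) = k. A relation, as the distance is undefined for vertices in
  -- different components.
  IsDistance : Fin n → Fin n → ℕ → Set
  IsDistance u v k = Path u v k × (∀ {l} → Path u v l → k ≤ l)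

  -- In particular, G is connected.
  HasDiameter : ℕ → Set
  HasDiameter d =
    (∀ u v → ∃[ k ] IsDistance u v k × k ≤ d) ×
    (∃[ u ] ∃[ v ] IsDistance u v d)

  -- There are no multiple edges, so edges incident to v correspond to
  -- neighbors of v.
  deg : Fin n → ℕ
  deg v = length (filter (v ~?_) (allFin n))

  distance2⁺ : ∀ {u v} →
               u ≢ v × ¬ (u ~ v) × ∃[ w ] (u ~ w × w ~ v) → IsDistance u v 2
  distance2⁺ {u} {v} (u≢v , u≁v , w , u~w , w~v) =
    ( u~w ∷ w~v ∷ []
    , ((λ e → ~-irrefl e u~w) ∷ u≢v ∷ []) ∷ ((λ e → ~-irrefl e w~v) ∷ [])
      ∷ [] ∷ [] )
    , shortest
    where
    shortest : ∀ {l} → Path u v l → 2 ≤ l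
    shortest ([] , _)         = ⊥-elim (u≢v refl)
    shortest (e ∷ [] , _)     = ⊥-elim (u≁v e)
    shortest (_ ∷ _ ∷ _ , _)  = s≤s (s≤s z≤n)

  distance2⁻ : ∀ {u v} →
               IsDistance u v 2 → u ≢ v × ¬ (u ~ v) × ∃[ w ] (u ~ w × w ~ v)
  distance2⁻ {u} {v} ((u~w ∷ w~v ∷ [] , _) , shortest) =
    u≢v , u≁v , _ , u~w , w~v
    where
    u≢v : u ≢ v
    u≢v refl with () ← shortest ([] , [] ∷ [])
    u≁v : ¬ (u ~ v)
    u≁v e with s≤s () ← shortest (e ∷ [] , ((λ q → ~-irrefl q e) ∷ []) ∷ [] ∷ [])

  distance2? : ∀ u v → Dec (IsDistance u v 2)
  distance2? u v = map′ distance2⁺ distance2⁻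
    (¬? (u ≟ v) ×-dec ¬? (u ~? v) ×-dec any? (λ w → (u ~? w) ×-dec (w ~? v)))

  N₂ : Fin n → List (Fin n)
  N₂ v = filter (distance2? v) (allFin n)

  N₂DLᵛ : Fin n → List ℕ
  N₂DLᵛ v = sort↓ (map deg (N₂ v))

  -- Indexed by the vertices: entry v is the list of v, so graphs on the same
  -- vertex set with equal N₂DL agree vertex by vertex.
  N₂DL : Vec (List ℕ) n
  N₂DL = tabulate N₂DLᵛ

-- Equality of the unordered pairs {x,y} and {u,v}.
SamePair : ∀ {n} → (x y u v : Fin n) → Set
SamePair x y u v = (x ≡ u × y ≡ v) ⊎ (x ≡ v × y ≡ u)

-- G′ arises from G by replacing v₁v₂, w₁w₂ with v₁w₂, v₂w₁. The new edges must
-- not be loops; with the adjacency conditions, v₁, v₂, w₁, w₂ are then distinct.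
record Is2Switch {n} (G G′ : Graph n) (v₁ v₂ w₁ w₂ : Fin n) : Set where
  private
    module G  = Graph G
    module G′ = Graph G′
  field
    v₁~v₂ : v₁ G.~ v₂
    w₁~w₂ : w₁ G.~ w₂
    v₁≢w₂ : v₁ ≢ w₂
    v₂≢w₁ : v₂ ≢ w₁
    v₁≁w₂ : ¬ (v₁ G.~ w₂)
    v₂≁w₁ : ¬ (v₂ G.~ w₁)
    edges : ∀ x y → (x G′.~ y) ⇔
              ( (x G.~ y × ¬ SamePair x y v₁ v₂ × ¬ SamePair x y w₁ w₂)
              ⊎ SamePair x y v₁ w₂
              ⊎ SamePair x y v₂ w₁ )

DegreeRestricted2Switch : ∀ {n} → Graph n → Graph n → Set
DegreeRestricted2Switch G G′ =
  ∃[ v₁ ] ∃[ v₂ ] ∃[ w₁ ] ∃[ w₂ ]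
    Is2Switch G G′ v₁ v₂ w₁ w₂ × deg G v₁ ≡ deg G w₁ × deg G v₂ ≡ deg G w₂

-- The final _≈_ matters only for the empty sequence of switches.
TransformsInto : ∀ {n} → Graph n → Graph n → Set₁
TransformsInto G H = ∃[ K ] Star DegreeRestricted2Switch G K × K ≈ H

{-# OPTIONS --safe #-}
-- In a graph of diameter 2 the vertices at distance 2 from v are those that are neither v
-- nor adjacent to v, so N₂DL records, for every v and d, the number of neighbors of v of
-- degree d. Degree restricted 2-switches preserve these numbers.
--
-- Conversely, let G and H have the same numbers. Make the rows of the adjacency matrices
-- agree one after another, entry by entry. If v ~ x in G but not in H, then v ~ y in H but
-- not in G for some y with deg y = deg x. Among the vertices of degree deg v, x and y have
-- the same number of neighbors in G as in H, so there is z with deg z = deg v whose row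
-- does not agree yet, such that either vx, zy → vy, zx is a switch in G, or vy, zx → vx, zy
-- is a switch in H. Either one makes the entry vx agree and touches only the rows of
-- v, x, y, z, none of which had been completed. Finally, switches are reversible.

module Submission where

open import Defs
open import Data.Nat.Base using (ℕ; zero; suc; _+_; _*_; _≤_; _<_; z≤n; s≤s)
import Data.Nat.Properties as ℕ
open import Data.Nat.ListAction using () renaming (sum to sumᴸ)
open import Data.Nat.ListAction.Properties using (sum-↭)
open import Data.Fin.Base using (Fin; zero; suc)
open import Data.Fin.Properties using (_≟_)
open import Data.Fin.Permutation using (transpose; _⟨$⟩ʳ_)
open import Data.List.Base using (List; []; _∷_; _++_; length; map; filter; tabulate; allFin)
open import Data.List.Properties using (map-∘)
open import Data.List.Membership.Propositional using (_∈_)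
open import Data.List.Membership.Propositional.Properties using (∈-∃++; ∈-allFin)
open import Data.List.Relation.Unary.Any using (here; there)
open import Data.List.Relation.Binary.Permutation.Propositional
  using (_↭_; ↭-refl; ↭-sym; ↭-trans; prep; ↭⇒↭ₛ)
open import Data.List.Relation.Binary.Permutation.Propositional.Properties using (shift; map⁺)
open import Data.List.Relation.Binary.Pointwise using (Pointwise-≡⇒≡)
open import Data.List.Relation.Unary.Sorted.TotalOrder.Properties using (↗↭↗⇒≋)
import Data.List.Sort as Sort
open import Data.Vec.Properties using (lookup∘tabulate; tabulate-cong)
open import Data.Vec.Base using (lookup)
open import Data.Bool.Base using (true; false)
open import Data.Product.Base using (∃-syntax; _×_; _,_; proj₁; proj₂)
open import Data.Sum.Base using (_⊎_; inj₁; inj₂; [_,_]′)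
import Data.Sum.Base as Sum
open import Data.Empty using (⊥-elim)
open import Function.Base using (_∘_; const; id)
open import Function.Bundles using (_⇔_; mk⇔; Equivalence)
open import Function.Construct.Composition using (_⇔-∘_)
open import Function.Construct.Symmetry using (⇔-sym)
open import Relation.Nullary.Negation using (¬_; contradiction)
open import Relation.Nullary.Decidable
  using (Dec; yes; no; _because_; ¬?; _×-dec_; _⊎-dec_; dec-true; dec-false; decidable-stable)
open import Relation.Unary using (Decidable)
open import Relation.Binary.Construct.Closure.ReflexiveTransitive
  using (Star; ε; _◅_; _◅◅_; reverse)
import Relation.Binary.Construct.Flip.EqAndOrd as Flip
open import Relation.Binary.Bundles using (DecTotalOrder)
open import Relation.Binary.PropositionalEquality
  using (_≡_; _≢_; refl; sym; trans; cong; cong₂; subst; subst₂; module ≡-Reasoning)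
open import Algebra.Properties.CommutativeMonoid.Sum ℕ.+-0-commutativeMonoid
  using (sum; sum-cong-≗; ∑-distrib-+; sum-permute)

-- Indicators, comparison of finite sums, transposed summands.

𝟙 : ∀ {p} {P : Set p} → Dec P → ℕ
𝟙 (true  because _) = 1
𝟙 (false because _) = 0

𝟙-yes : ∀ {p} {P : Set p} (P? : Dec P) → P → 𝟙 P? ≡ 1
𝟙-yes (yes _) _ = refl
𝟙-yes (no ¬p) p = contradiction p ¬p

𝟙-no : ∀ {p} {P : Set p} (P? : Dec P) → ¬ P → 𝟙 P? ≡ 0
𝟙-no (yes p) ¬p = contradiction p ¬p
𝟙-no (no _)  _  = refl

𝟙-cong : ∀ {p q} {P : Set p} {Q : Set q} (P? : Dec P) (Q? : Dec Q) →
         P ⇔ Q → 𝟙 P? ≡ 𝟙 Q?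
𝟙-cong (yes p) Q? eq = sym (𝟙-yes Q? (Equivalence.to eq p))
𝟙-cong (no ¬p) Q? eq = sym (𝟙-no Q? (¬p ∘ Equivalence.from eq))

𝟙-compare : ∀ {p q} {P : Set p} {Q : Set q} (P? : Dec P) (Q? : Dec Q) →
            (P × ¬ Q) ⊎ 𝟙 P? ≤ 𝟙 Q?
𝟙-compare (no _)  _       = inj₂ z≤n
𝟙-compare (yes _) (yes _) = inj₂ ℕ.≤-refl
𝟙-compare (yes p) (no ¬q) = inj₁ (p , ¬q)

sum-<⇒∃ : ∀ {n} (f g : Fin n → ℕ) → sum f < sum g → ∃[ i ] f i < g i
sum-<⇒∃ {suc n} f g F<G with f zero ℕ.<? g zero
... | yes lt = zero , lt
... | no ≮   with i , lt ← sum-<⇒∃ (f ∘ suc) (g ∘ suc) (ℕ.+-cancelˡ-< (g zero) _ _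
                     (ℕ.≤-<-trans (ℕ.+-monoˡ-≤ _ (ℕ.≮⇒≥ ≮)) F<G)) = suc i , lt

-- Without a gain somewhere, the loss at `i` would push `sum f` above `sum g`. The column `y` and
-- the row `z` of each switch are found this way.
sum-≤⇒∃ : ∀ {n} (f g : Fin n → ℕ) (i : Fin n) → sum f ≤ sum g → g i < f i → ∃[ j ] f j < g j
sum-≤⇒∃ f g zero F≤G lt
  with j , lt′ ← sum-<⇒∃ (f ∘ suc) (g ∘ suc)
                   (ℕ.+-cancelˡ-< (g zero) _ _ (ℕ.<-≤-trans (ℕ.+-monoˡ-< _ lt) F≤G))
  = suc j , lt′
sum-≤⇒∃ f g (suc i) F≤G lt with f zero ℕ.<? g zero
... | yes lt′ = zero , lt′
... | no ≮    with j , lt′ ← sum-≤⇒∃ (f ∘ suc) (g ∘ suc) i (ℕ.+-cancelˡ-≤ (g zero) _ _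
                      (ℕ.≤-trans (ℕ.+-monoˡ-≤ _ (ℕ.≮⇒≥ ≮)) F≤G)) lt = suc j , lt′

module _ {n} (i j : Fin n) where

  transpose-left : transpose i j ⟨$⟩ʳ i ≡ j
  transpose-left rewrite dec-true (i ≟ i) refl = refl

  transpose-right : transpose i j ⟨$⟩ʳ j ≡ i
  transpose-right with j ≟ i
  ... | yes j≡i = j≡i
  ... | no  _   rewrite dec-true (j ≟ j) refl = refl

  transpose-other : ∀ {k} → k ≢ i → k ≢ j → transpose i j ⟨$⟩ʳ k ≡ k
  transpose-other {k} k≢i k≢j
    rewrite dec-false (k ≟ i) k≢i | dec-false (k ≟ j) k≢j = refl

sum-transposed : ∀ {n} (f g : Fin n → ℕ) (i j : Fin n) → f i ≡ g j → f j ≡ g i →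
                 (∀ k → k ≢ i → k ≢ j → f k ≡ g k) → sum f ≡ sum g
sum-transposed f g i j fi≡gj fj≡gi f≡g =
  trans (sum-cong-≗ pointwise) (sym (sum-permute g (transpose i j)))
  where
  pointwise : ∀ k → f k ≡ g (transpose i j ⟨$⟩ʳ k)
  pointwise k with k ≟ i
  ... | yes refl = fi≡gj
  ... | no k≢i with k ≟ j
  ...   | yes refl = fj≡gi
  ...   | no k≢j   = f≡g k k≢i k≢j

-- Sums over lists, multisets and descending sorting.

sum-map-filter-tabulate :
  ∀ {p m} {A : Set} {P : A → Set p} (P? : Decidable P) (f : A → ℕ) (g : Fin m → A) →
  sumᴸ (map f (filter P? (tabulate g))) ≡ sum (λ i → 𝟙 (P? (g i)) * f (g i))
sum-map-filter-tabulate {m = zero}  P? f g = refl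
sum-map-filter-tabulate {m = suc m} P? f g with P? (g zero)
... | yes _ = cong₂ _+_ (sym (ℕ.+-identityʳ _)) (sum-map-filter-tabulate P? f (g ∘ suc))
... | no  _ = sum-map-filter-tabulate P? f (g ∘ suc)

length≡sum : ∀ {A : Set} (xs : List A) → length xs ≡ sumᴸ (map (const 1) xs)
length≡sum []       = refl
length≡sum (_ ∷ xs) = cong suc (length≡sum xs)

0<sum-𝟙⇒∈ : ∀ x xs → 0 < sumᴸ (map (λ y → 𝟙 (x ℕ.≟ y)) xs) → x ∈ xs
0<sum-𝟙⇒∈ x (y ∷ xs) 0<s with x ℕ.≟ y
... | yes x≡y = here x≡y
... | no  _   = there (0<sum-𝟙⇒∈ x xs 0<s)

-- The indicator of the head `x` has a positive sum over `x ∷ xs`, hence over `ys`, so `x` occurs in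
-- `ys`. Deleting it there subtracts `φ x` from both sides for every `φ`.
sums⇒↭ : ∀ (xs ys : List ℕ) → (∀ (φ : ℕ → ℕ) → sumᴸ (map φ xs) ≡ sumᴸ (map φ ys)) → xs ↭ ys
sums⇒↭ []       []      eq = ↭-refl
sums⇒↭ []       (_ ∷ _) eq with () ← eq (const 1)
sums⇒↭ (x ∷ xs) ys      eq
  with as , bs , refl ← ∈-∃++ (0<sum-𝟙⇒∈ x ys
         (subst (0 <_) (eq (λ y → 𝟙 (x ℕ.≟ y)))
           (subst (λ m → 0 < m + sumᴸ (map (λ y → 𝟙 (x ℕ.≟ y)) xs))
             (sym (𝟙-yes (x ℕ.≟ x) refl)) (s≤s z≤n))))
  = ↭-trans (prep x (sums⇒↭ xs (as ++ bs) rest)) (↭-sym (shift x as bs))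
  where
  rest : ∀ φ → sumᴸ (map φ xs) ≡ sumᴸ (map φ (as ++ bs))
  rest φ = ℕ.+-cancelˡ-≡ (φ x) _ _ (trans (eq φ) (sum-↭ (map⁺ φ (shift x as bs))))

≥-decTotalOrder : DecTotalOrder _ _ _
≥-decTotalOrder = Flip.decTotalOrder ℕ.≤-decTotalOrder

module Sort↓ = Sort ≥-decTotalOrder

↭⇒sort↓≡ : ∀ {xs ys} → xs ↭ ys → sort↓ xs ≡ sort↓ ys
↭⇒sort↓≡ {xs} {ys} xs↭ys = Pointwise-≡⇒≡
  (↗↭↗⇒≋ (DecTotalOrder.totalOrder ≥-decTotalOrder) (Sort↓.sort-↗ xs) (Sort↓.sort-↗ ys)
    (↭⇒↭ₛ (↭-trans (Sort↓.sort-↭ xs) (↭-trans xs↭ys (↭-sym (Sort↓.sort-↭ ys))))))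

-- Sums over neighbors and over vertices at distance 2.

module _ {n} (G : Graph n) where
  open Graph G

  adj : Fin n → Fin n → ℕ
  adj v w = 𝟙 (v ~? w)

  nbrSum : Fin n → (Fin n → ℕ) → ℕ
  nbrSum v ψ = sum (λ w → adj v w * ψ w)

  N₂Sum : Fin n → (Fin n → ℕ) → ℕ
  N₂Sum v ψ = sum (λ w → 𝟙 (distance2? G v w) * ψ w)

  adj-sym : ∀ v w → adj v w ≡ adj w v
  adj-sym v w = 𝟙-cong (v ~? w) (w ~? v) (mk⇔ ~-sym ~-sym)

  deg≡nbrSum : ∀ v → deg G v ≡ nbrSum v (const 1)
  deg≡nbrSum v = trans (length≡sum (filter (v ~?_) (allFin n)))
                         (sum-map-filter-tabulate (v ~?_) (const 1) id)

  N₂DL-sum : ∀ v φ → sumᴸ (map φ (N₂DLᵛ G v)) ≡ N₂Sum v (φ ∘ deg G)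
  N₂DL-sum v φ = begin
    sumᴸ (map φ (N₂DLᵛ G v))              ≡⟨ sum-↭ (map⁺ φ (Sort↓.sort-↭ _)) ⟩
    sumᴸ (map φ (map (deg G) (N₂ G v)))   ≡⟨ cong sumᴸ (map-∘ (N₂ G v)) ⟨
    sumᴸ (map (φ ∘ deg G) (N₂ G v))       ≡⟨ sum-map-filter-tabulate (distance2? G v) _ id ⟩
    N₂Sum v (φ ∘ deg G)                   ∎
    where open ≡-Reasoning

  module _ (diameter2 : HasDiameter G 2) where

    -- Here diameter 2 enters: the distance is 0, 1 or 2, and each value makes exactly one of the
    -- three indicators equal to 1.
    distance012 : ∀ v w → 𝟙 (v ≟ w) + (adj v w + 𝟙 (distance2? G v w)) ≡ 1
    distance012 v w with proj₁ diameter2 v w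
    ... | 0 , (([] , _) , _) , _
      rewrite 𝟙-yes (v ≟ v) refl | 𝟙-no (v ~? v) (~-irrefl refl)
            | 𝟙-no (distance2? G v v) (λ d → proj₁ (distance2⁻ G d) refl) = refl
    ... | 1 , ((v~w ∷ [] , _) , _) , _
      rewrite 𝟙-no (v ≟ w) (λ eq → ~-irrefl eq v~w) | 𝟙-yes (v ~? w) v~w
            | 𝟙-no (distance2? G v w) (λ d → proj₁ (proj₂ (distance2⁻ G d)) v~w) = refl
    ... | 2 , d , _
      rewrite 𝟙-no (v ≟ w) (proj₁ (distance2⁻ G d))
            | 𝟙-no (v ~? w) (proj₁ (proj₂ (distance2⁻ G d)))
            | 𝟙-yes (distance2? G v w) d = refl
    ... | suc (suc (suc _)) , _ , s≤s (s≤s ())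

    -- Neither the first term nor the right-hand side depends on the edges. Hence two graphs with
    -- equal `nbrSum` for some `v` and `ψ` have equal `N₂Sum`, and conversely.
    sum-by-distance : ∀ v ψ → sum (λ w → 𝟙 (v ≟ w) * ψ w) + (nbrSum v ψ + N₂Sum v ψ) ≡ sum ψ
    sum-by-distance v ψ = begin
      sum e + (nbrSum v ψ + N₂Sum v ψ)  ≡⟨ cong (sum e +_) (∑-distrib-+ a b) ⟨
      sum e + sum (λ w → a w + b w)     ≡⟨ ∑-distrib-+ e (λ w → a w + b w) ⟨
      sum (λ w → e w + (a w + b w))     ≡⟨ sum-cong-≗ pointwise ⟩
      sum ψ                             ∎
      where
      open ≡-Reasoning
      e a b : Fin n → ℕ
      e w = 𝟙 (v ≟ w) * ψ w
      a w = adj v w * ψ w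
      b w = 𝟙 (distance2? G v w) * ψ w
      pointwise : ∀ w → e w + (a w + b w) ≡ ψ w
      pointwise w = begin
        e w + (a w + b w)
          ≡⟨ cong (e w +_) (ℕ.*-distribʳ-+ (ψ w) (adj v w) _) ⟨
        e w + (adj v w + 𝟙 (distance2? G v w)) * ψ w
          ≡⟨ ℕ.*-distribʳ-+ (ψ w) (𝟙 (v ≟ w)) _ ⟨
        (𝟙 (v ≟ w) + (adj v w + 𝟙 (distance2? G v w))) * ψ w
          ≡⟨ cong (_* ψ w) (distance012 v w) ⟩
        1 * ψ w
          ≡⟨ ℕ.*-identityˡ (ψ w) ⟩
        ψ w ∎

-- The test functions φ = 1 and φ = [_≟ d] recover the degrees and the number of neighbors
-- of each degree.
infix 4 _≃_
record _≃_ {n} (G H : Graph n) : Set where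
  constructor mk≃
  field nbrSum≡ : ∀ v (φ : ℕ → ℕ) → nbrSum G v (φ ∘ deg G) ≡ nbrSum H v (φ ∘ deg H)

open _≃_

module _ {n} (G : Graph n) where

  nbrSum-cong : ∀ v {ψ χ : Fin n → ℕ} → (∀ w → ψ w ≡ χ w) → nbrSum G v ψ ≡ nbrSum G v χ
  nbrSum-cong v ψ≗χ = sum-cong-≗ (λ w → cong (adj G v w *_) (ψ≗χ w))

  N₂Sum-cong : ∀ v {ψ χ : Fin n → ℕ} → (∀ w → ψ w ≡ χ w) → N₂Sum G v ψ ≡ N₂Sum G v χ
  N₂Sum-cong v ψ≗χ = sum-cong-≗ (λ w → cong (𝟙 (distance2? G v w) *_) (ψ≗χ w))

module _ {n} {G H : Graph n} where

  ≃⇒deg≡ : G ≃ H → ∀ v → deg G v ≡ deg H v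
  ≃⇒deg≡ G≃H v = trans (deg≡nbrSum G v) (trans (nbrSum≡ G≃H v (const 1)) (sym (deg≡nbrSum H v)))

  ≃⇒deg-pair : G ≃ H → ∀ {v w} → deg G v ≡ deg G w → deg H v ≡ deg H w
  ≃⇒deg-pair G≃H {v} {w} eq = trans (sym (≃⇒deg≡ G≃H v)) (trans eq (≃⇒deg≡ G≃H w))

≃-sym : ∀ {n} {G H : Graph n} → G ≃ H → H ≃ G
≃-sym G≃H = mk≃ λ v φ → sym (nbrSum≡ G≃H v φ)

≃-trans : ∀ {n} {G H K : Graph n} → G ≃ H → H ≃ K → G ≃ K
≃-trans G≃H H≃K = mk≃ λ v φ → trans (nbrSum≡ G≃H v φ) (nbrSum≡ H≃K v φ)

module _ {n} {G H : Graph n} where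

  ≃⇒nbrSum≡ : G ≃ H → ∀ v φ → nbrSum G v (φ ∘ deg G) ≡ nbrSum H v (φ ∘ deg G)
  ≃⇒nbrSum≡ G≃H v φ =
    trans (nbrSum≡ G≃H v φ) (nbrSum-cong H v (λ w → cong φ (sym (≃⇒deg≡ G≃H w))))

  -- The case `φ = const 1` already shows the degrees equal, so the weights may be read off in `G`
  -- on both sides.
  nbrSum≡⇒≃ : (∀ v φ → nbrSum G v (φ ∘ deg G) ≡ nbrSum H v (φ ∘ deg G)) → G ≃ H
  nbrSum≡⇒≃ eq = mk≃ λ v φ → trans (eq v φ) (nbrSum-cong H v (λ w → cong φ (deg≡ w)))
    where
    deg≡ : ∀ w → deg G w ≡ deg H w
    deg≡ w = trans (deg≡nbrSum G w) (trans (eq w (const 1)) (sym (deg≡nbrSum H w)))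

  ≈⇒≃ : G ≈ H → G ≃ H
  ≈⇒≃ G≈H = nbrSum≡⇒≃ λ v φ → sum-cong-≗ λ w →
    cong (_* φ (deg G w)) (𝟙-cong (Graph._~?_ G v w) (Graph._~?_ H v w) (G≈H v w))

  module _ (G₂ : HasDiameter G 2) (H₂ : HasDiameter H 2) where

    nbrSum≡⇒N₂Sum≡ : ∀ v ψ → nbrSum G v ψ ≡ nbrSum H v ψ → N₂Sum G v ψ ≡ N₂Sum H v ψ
    nbrSum≡⇒N₂Sum≡ v ψ eq = ℕ.+-cancelˡ-≡ (nbrSum G v ψ) _ _ (ℕ.+-cancelˡ-≡ e _ _ (begin
      e + (nbrSum G v ψ + N₂Sum G v ψ)  ≡⟨ sum-by-distance G G₂ v ψ ⟩
      sum ψ                             ≡⟨ sum-by-distance H H₂ v ψ ⟨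
      e + (nbrSum H v ψ + N₂Sum H v ψ)  ≡⟨ cong (λ m → e + (m + N₂Sum H v ψ)) eq ⟨
      e + (nbrSum G v ψ + N₂Sum H v ψ)  ∎))
      where
      open ≡-Reasoning
      e = sum (λ w → 𝟙 (v ≟ w) * ψ w)

    N₂Sum≡⇒nbrSum≡ : ∀ v ψ → N₂Sum G v ψ ≡ N₂Sum H v ψ → nbrSum G v ψ ≡ nbrSum H v ψ
    N₂Sum≡⇒nbrSum≡ v ψ eq = ℕ.+-cancelʳ-≡ (N₂Sum G v ψ) _ _ (ℕ.+-cancelˡ-≡ e _ _ (begin
      e + (nbrSum G v ψ + N₂Sum G v ψ)  ≡⟨ sum-by-distance G G₂ v ψ ⟩
      sum ψ                             ≡⟨ sum-by-distance H H₂ v ψ ⟨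
      e + (nbrSum H v ψ + N₂Sum H v ψ)  ≡⟨ cong (λ m → e + (nbrSum H v ψ + m)) eq ⟨
      e + (nbrSum H v ψ + N₂Sum G v ψ)  ∎))
      where
      open ≡-Reasoning
      e = sum (λ w → 𝟙 (v ≟ w) * ψ w)

    ≃⇒N₂DL≡ : G ≃ H → N₂DL G ≡ N₂DL H
    ≃⇒N₂DL≡ G≃H = tabulate-cong λ v → ↭⇒sort↓≡ (sums⇒↭ _ _ λ φ → begin
      sumᴸ (map φ (map (deg G) (N₂ G v)))  ≡⟨ sum-↭ (map⁺ φ (Sort↓.sort-↭ _)) ⟨
      sumᴸ (map φ (N₂DLᵛ G v))             ≡⟨ N₂DL-sum G v φ ⟩
      -- Trading neighbors for vertices at distance 2 needs one weight common to both graphs, so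
      -- `deg G` is kept until afterwards.
      N₂Sum G v (φ ∘ deg G)                ≡⟨ nbrSum≡⇒N₂Sum≡ v _ (≃⇒nbrSum≡ G≃H v φ) ⟩
      N₂Sum H v (φ ∘ deg G)                ≡⟨ N₂Sum-cong H v (λ w → cong φ (≃⇒deg≡ G≃H w)) ⟩
      N₂Sum H v (φ ∘ deg H)                ≡⟨ N₂DL-sum H v φ ⟨
      sumᴸ (map φ (N₂DLᵛ H v))             ≡⟨ sum-↭ (map⁺ φ (Sort↓.sort-↭ _)) ⟩
      sumᴸ (map φ (map (deg H) (N₂ H v)))  ∎)
      where open ≡-Reasoning

    -- The constant weight mentions no degrees, so complementing it at once shows `deg G` and
    -- `deg H` equal. Only then do the other test functions give a weight common to both graphs.
    N₂DL≡⇒≃ : N₂DL G ≡ N₂DL H → G ≃ H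
    N₂DL≡⇒≃ eq = nbrSum≡⇒≃ λ v φ → N₂Sum≡⇒nbrSum≡ v _
      (trans (N₂Sum≡ v φ) (N₂Sum-cong H v (λ w → cong φ (sym (deg≡ w)))))
      where
      open ≡-Reasoning
      lists≡ : ∀ v → N₂DLᵛ G v ≡ N₂DLᵛ H v
      lists≡ v = trans (sym (lookup∘tabulate (N₂DLᵛ G) v))
                   (trans (cong (λ l → lookup l v) eq) (lookup∘tabulate (N₂DLᵛ H) v))
      N₂Sum≡ : ∀ v φ → N₂Sum G v (φ ∘ deg G) ≡ N₂Sum H v (φ ∘ deg H)
      N₂Sum≡ v φ = trans (sym (N₂DL-sum G v φ))
                     (trans (cong (sumᴸ ∘ map φ) (lists≡ v)) (N₂DL-sum H v φ))
      deg≡ : ∀ w → deg G w ≡ deg H w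
      deg≡ w = trans (deg≡nbrSum G w)
                 (trans (N₂Sum≡⇒nbrSum≡ w (const 1) (N₂Sum≡ w (const 1)))
                   (sym (deg≡nbrSum H w)))

-- 2-switches, their symmetries and their effect on neighbor sums.

SamePair-sym : ∀ {n} {x y u v : Fin n} → SamePair x y u v → SamePair y x u v
SamePair-sym (inj₁ (x≡u , y≡v)) = inj₂ (y≡v , x≡u)
SamePair-sym (inj₂ (x≡v , y≡u)) = inj₁ (y≡u , x≡v)

SamePair-swap : ∀ {n} {x y u v : Fin n} → SamePair x y u v → SamePair x y v u
SamePair-swap (inj₁ p) = inj₂ p
SamePair-swap (inj₂ p) = inj₁ p

SamePair? : ∀ {n} (x y u v : Fin n) → Dec (SamePair x y u v)
SamePair? x y u v = ((x ≟ u) ×-dec (y ≟ v)) ⊎-dec ((x ≟ v) ×-dec (y ≟ u))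

≢⇒¬SamePair : ∀ {n} {x y u v : Fin n} → x ≢ u → x ≢ v → ¬ SamePair x y u v
≢⇒¬SamePair x≢u x≢v (inj₁ (x≡u , _)) = x≢u x≡u
≢⇒¬SamePair x≢u x≢v (inj₂ (x≡v , _)) = x≢v x≡v

≢⇒¬SamePairʳ : ∀ {n} {x y u v : Fin n} → x ≢ v → y ≢ v → ¬ SamePair x y u v
≢⇒¬SamePairʳ x≢v y≢v (inj₁ (_ , y≡v)) = y≢v y≡v
≢⇒¬SamePairʳ x≢v y≢v (inj₂ (x≡v , _)) = x≢v x≡v

module _ {n} {G G′ : Graph n} {v₁ v₂ w₁ w₂ : Fin n} (switch : Is2Switch G G′ v₁ v₂ w₁ w₂) where
  open Is2Switch switch
  private
    module G  = Graph G
    module G′ = Graph G′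

  v₁≢v₂ : v₁ ≢ v₂
  v₁≢v₂ e = G.~-irrefl e v₁~v₂

  w₁≢w₂ : w₁ ≢ w₂
  w₁≢w₂ e = G.~-irrefl e w₁~w₂

  v₁≢w₁ : v₁ ≢ w₁
  v₁≢w₁ refl = v₂≁w₁ (G.~-sym v₁~v₂)

  v₂≢w₂ : v₂ ≢ w₂
  v₂≢w₂ refl = v₁≁w₂ v₁~v₂

  v₁~′w₂ : v₁ G′.~ w₂
  v₁~′w₂ = Equivalence.from (edges _ _) (inj₂ (inj₁ (inj₁ (refl , refl))))

  v₁≁′v₂ : ¬ (v₁ G′.~ v₂)
  v₁≁′v₂ v₁~′v₂ with Equivalence.to (edges _ _) v₁~′v₂
  ... | inj₁ (_ , ¬p , _)             = ¬p (inj₁ (refl , refl))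
  ... | inj₂ (inj₁ (inj₁ (_ , e)))    = v₂≢w₂ e
  ... | inj₂ (inj₁ (inj₂ (e , _)))    = v₁≢w₂ e
  ... | inj₂ (inj₂ (inj₁ (e , _)))    = v₁≢v₂ e
  ... | inj₂ (inj₂ (inj₂ (e , _)))    = v₁≢w₁ e

  unchanged : ∀ {x y} → ¬ SamePair x y v₁ v₂ → ¬ SamePair x y w₁ w₂ →
              ¬ SamePair x y v₁ w₂ → ¬ SamePair x y v₂ w₁ → (x G′.~ y) ⇔ (x G.~ y)
  unchanged {x} {y} ¬v ¬w ¬vw ¬wv = mk⇔
    (λ e → [ proj₁ , [ ⊥-elim ∘ ¬vw , ⊥-elim ∘ ¬wv ]′ ]′ (Equivalence.to (edges x y) e))
    (λ e → Equivalence.from (edges x y) (inj₁ (e , ¬v , ¬w)))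

  unchanged-row : ∀ {x} → x ≢ v₁ → x ≢ v₂ → x ≢ w₁ → x ≢ w₂ → ∀ y → (x G′.~ y) ⇔ (x G.~ y)
  unchanged-row a b c d y =
    unchanged (≢⇒¬SamePair a b) (≢⇒¬SamePair c d) (≢⇒¬SamePair a d) (≢⇒¬SamePair b c)

  unchanged-in-row-v₁ : ∀ {y} → y ≢ v₂ → y ≢ w₂ → (v₁ G′.~ y) ⇔ (v₁ G.~ y)
  unchanged-in-row-v₁ y≢v₂ y≢w₂ =
    unchanged (≢⇒¬SamePairʳ v₁≢v₂ y≢v₂) (≢⇒¬SamePair v₁≢w₁ v₁≢w₂)
              (≢⇒¬SamePairʳ v₁≢w₂ y≢w₂) (≢⇒¬SamePair v₁≢v₂ v₁≢w₁)

  -- In row `v₁` the entries at `v₂` and `w₂` trade values, and `ψ` does not tell these two vertices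
  -- apart.
  switch-nbrSum-v₁ : ∀ ψ → ψ v₂ ≡ ψ w₂ → nbrSum G′ v₁ ψ ≡ nbrSum G v₁ ψ
  switch-nbrSum-v₁ ψ ψv₂≡ψw₂ = sum-transposed _ _ v₂ w₂
    (cong₂ _*_ (trans (𝟙-no (v₁ G′.~? v₂) v₁≁′v₂) (sym (𝟙-no (v₁ G.~? w₂) v₁≁w₂))) ψv₂≡ψw₂)
    (cong₂ _*_ (trans (𝟙-yes (v₁ G′.~? w₂) v₁~′w₂) (sym (𝟙-yes (v₁ G.~? v₂) v₁~v₂)))
      (sym ψv₂≡ψw₂))
    (λ y y≢v₂ y≢w₂ → cong (_* ψ y)
      (𝟙-cong (v₁ G′.~? y) (v₁ G.~? y) (unchanged-in-row-v₁ y≢v₂ y≢w₂)))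

  -- Together with `switch-exchange` this brings any of the four vertices into position `v₁`, so
  -- facts about row `v₁` cover all four rows.
  switch-flip : Is2Switch G G′ v₂ v₁ w₂ w₁
  switch-flip = record
    { v₁~v₂ = G.~-sym v₁~v₂
    ; w₁~w₂ = G.~-sym w₁~w₂
    ; v₁≢w₂ = v₂≢w₁
    ; v₂≢w₁ = v₁≢w₂
    ; v₁≁w₂ = v₂≁w₁
    ; v₂≁w₁ = v₁≁w₂
    ; edges = λ x y → mk⇔
        (λ e → Sum.map (λ (a , b , c) → a , b ∘ SamePair-swap , c ∘ SamePair-swap) Sum.swap
                 (Equivalence.to (edges x y) e))
        (λ e → Equivalence.from (edges x y)
                 (Sum.map (λ (a , b , c) → a , b ∘ SamePair-swap , c ∘ SamePair-swap) Sum.swap e))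
    }

  switch-exchange : Is2Switch G G′ w₁ w₂ v₁ v₂
  switch-exchange = record
    { v₁~v₂ = w₁~w₂
    ; w₁~w₂ = v₁~v₂
    ; v₁≢w₂ = v₂≢w₁ ∘ sym
    ; v₂≢w₁ = v₁≢w₂ ∘ sym
    ; v₁≁w₂ = v₂≁w₁ ∘ G.~-sym
    ; v₂≁w₁ = v₁≁w₂ ∘ G.~-sym
    ; edges = λ x y → mk⇔
        (λ e → Sum.map (λ (a , b , c) → a , c , b)
                 (Sum.swap ∘ Sum.map SamePair-swap SamePair-swap) (Equivalence.to (edges x y) e))
        (λ e → Equivalence.from (edges x y)
                 (Sum.map (λ (a , b , c) → a , c , b)
                   (Sum.swap ∘ Sum.map SamePair-swap SamePair-swap) e))
    }

module _ {n} {G G′ : Graph n} {v₁ v₂ w₁ w₂ : Fin n} (switch : Is2Switch G G′ v₁ v₂ w₁ w₂) where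
  open Is2Switch switch
  private
    module G  = Graph G
    module G′ = Graph G′

  -- An edge of `G` is either one of the two that the reversal restores, or survives the switch. In
  -- the latter case it is not an edge that the reversal removes, as those are absent from `G`.
  switch-reverse : Is2Switch G′ G v₁ w₂ w₁ v₂
  switch-reverse = record
    { v₁~v₂ = v₁~′w₂ switch
    ; w₁~w₂ = v₁~′w₂ (switch-exchange switch)
    ; v₁≢w₂ = v₁≢v₂ switch
    ; v₂≢w₁ = w₁≢w₂ switch ∘ sym
    ; v₁≁w₂ = v₁≁′v₂ switch
    ; v₂≁w₁ = v₁≁′v₂ (switch-exchange switch) ∘ G′.~-sym
    ; edges = λ x y → mk⇔ (to x y) (from x y)
    }
    where
    respects : ∀ (K : Graph n) {x y u v} → SamePair x y u v → Graph._~_ K x y → Graph._~_ K u v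
    respects K (inj₁ (refl , refl)) e = e
    respects K (inj₂ (refl , refl)) e = Graph.~-sym K e

    to : ∀ x y → x G.~ y → _
    to x y e with SamePair? x y v₁ v₂ | SamePair? x y w₁ w₂
    ... | yes p | _     = inj₂ (inj₁ p)
    ... | no _  | yes p = inj₂ (inj₂ (SamePair-swap p))
    ... | no ¬p | no ¬q = inj₁
      ( Equivalence.from (edges x y) (inj₁ (e , ¬p , ¬q))
      , (λ p → v₁≁w₂ (respects G p e))
      , (λ p → v₂≁w₁ (G.~-sym (respects G p e))) )

    from : ∀ x y → _ → x G.~ y
    from x y (inj₁ (e , ¬p , ¬q)) with Equivalence.to (edges x y) e
    ... | inj₁ (e′ , _)   = e′
    ... | inj₂ (inj₁ p)   = contradiction p ¬p
    ... | inj₂ (inj₂ p)   = contradiction (SamePair-swap p) ¬q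
    from x y (inj₂ (inj₁ (inj₁ (refl , refl)))) = v₁~v₂
    from x y (inj₂ (inj₁ (inj₂ (refl , refl)))) = G.~-sym v₁~v₂
    from x y (inj₂ (inj₂ (inj₁ (refl , refl)))) = G.~-sym w₁~w₂
    from x y (inj₂ (inj₂ (inj₂ (refl , refl)))) = w₁~w₂

  switch-nbrSum : ∀ ψ → ψ v₁ ≡ ψ w₁ → ψ v₂ ≡ ψ w₂ → ∀ x → nbrSum G′ x ψ ≡ nbrSum G x ψ
  switch-nbrSum ψ eq₁ eq₂ x with x ≟ v₁ | x ≟ v₂ | x ≟ w₁ | x ≟ w₂
  ... | yes refl | _ | _ | _ = switch-nbrSum-v₁ switch ψ eq₂
  ... | _ | yes refl | _ | _ = switch-nbrSum-v₁ (switch-flip switch) ψ eq₁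
  ... | _ | _ | yes refl | _ = switch-nbrSum-v₁ (switch-exchange switch) ψ (sym eq₂)
  ... | _ | _ | _ | yes refl =
    switch-nbrSum-v₁ (switch-flip (switch-exchange switch)) ψ (sym eq₁)
  ... | no a | no b | no c | no d = sum-cong-≗ λ y → cong (_* ψ y)
    (𝟙-cong (x G′.~? y) (x G.~? y) (unchanged-row switch a b c d y))

module _ {n : ℕ} where

  switch⇒≃ : {G G′ : Graph n} → DegreeRestricted2Switch G G′ → G ≃ G′
  switch⇒≃ {G} (_ , _ , _ , _ , switch , deg₁ , deg₂) = nbrSum≡⇒≃ λ v φ →
    sym (switch-nbrSum switch (φ ∘ deg G) (cong φ deg₁) (cong φ deg₂) v)

  switches⇒≃ : {G K : Graph n} → Star DegreeRestricted2Switch G K → G ≃ K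
  switches⇒≃ ε = mk≃ λ _ _ → refl
  switches⇒≃ (s ◅ ss) = ≃-trans (switch⇒≃ s) (switches⇒≃ ss)

  -- The reversal compares `v₁` with `w₁` and `w₂` with `v₂`, the same pairs as before, and all
  -- degrees are unchanged.
  switch-sym : {G G′ : Graph n} → DegreeRestricted2Switch G G′ → DegreeRestricted2Switch G′ G
  switch-sym {G} {G′} s@(v₁ , v₂ , w₁ , w₂ , switch , deg₁ , deg₂) =
    v₁ , w₂ , w₁ , v₂ , switch-reverse switch ,
    trans (deg≡ v₁) (trans deg₁ (sym (deg≡ w₁))) ,
    trans (deg≡ w₂) (trans (sym deg₂) (sym (deg≡ v₂)))
    where
    deg≡ : ∀ v → deg G′ v ≡ deg G v
    deg≡ = ≃⇒deg≡ (≃-sym (switch⇒≃ s))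

  switch-respˡ-≈ : {K L M : Graph n} → K ≈ L → DegreeRestricted2Switch L M →
                   DegreeRestricted2Switch K M
  switch-respˡ-≈ {K} {L} K≈L (v₁ , v₂ , w₁ , w₂ , switch , deg₁ , deg₂) =
    v₁ , v₂ , w₁ , w₂ , record
      { v₁~v₂ = from v₁~v₂
      ; w₁~w₂ = from w₁~w₂
      ; v₁≢w₂ = v₁≢w₂
      ; v₂≢w₁ = v₂≢w₁
      ; v₁≁w₂ = v₁≁w₂ ∘ to
      ; v₂≁w₁ = v₂≁w₁ ∘ to
      ; edges = λ x y → mk⇔
          (λ e → Sum.map₁ (λ (a , b) → from a , b) (Equivalence.to (edges x y) e))
          (λ e → Equivalence.from (edges x y) (Sum.map₁ (λ (a , b) → to a , b) e))
      } , trans (deg≡ v₁) (trans deg₁ (sym (deg≡ w₁)))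
        , trans (deg≡ v₂) (trans deg₂ (sym (deg≡ w₂)))
    where
    open Is2Switch switch
    deg≡ : ∀ v → deg K v ≡ deg L v
    deg≡ = ≃⇒deg≡ (≈⇒≃ {G = K} {L} K≈L)
    from : ∀ {x y} → Graph._~_ L x y → Graph._~_ K x y
    from = Equivalence.from (K≈L _ _)
    to : ∀ {x y} → Graph._~_ K x y → Graph._~_ L x y
    to = Equivalence.to (K≈L _ _)

  -- The first switch absorbs the difference between `K` and `L`; after it the sequence runs through
  -- the very same graphs.
  switches-respˡ-≈ : {K L H : Graph n} → K ≈ L → Star DegreeRestricted2Switch L H →
                     TransformsInto K H
  switches-respˡ-≈ {K} K≈L ε        = K , ε , K≈L
  switches-respˡ-≈     K≈L (s ◅ ss) =
    _ , switch-respˡ-≈ K≈L s ◅ ss , λ _ _ → mk⇔ id id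

module _ {n} (G : Graph n) where
  open Graph G

  -- The adjacency repeats the right-hand side of `edges` verbatim, so that `edges` holds by `id`.
  switchGraph : (v₁ v₂ w₁ w₂ : Fin n) → v₁ ≢ w₂ → v₂ ≢ w₁ → Graph n
  switchGraph v₁ v₂ w₁ w₂ v₁≢w₂ v₂≢w₁ = record
    { _~_      = λ x y → (x ~ y × ¬ SamePair x y v₁ v₂ × ¬ SamePair x y w₁ w₂)
                         ⊎ SamePair x y v₁ w₂ ⊎ SamePair x y v₂ w₁
    ; ~-irrefl = λ { refl (inj₁ (e , _)) → ~-irrefl refl e
                   ; refl (inj₂ (inj₁ (inj₁ (refl , e)))) → v₁≢w₂ e
                   ; refl (inj₂ (inj₁ (inj₂ (refl , e)))) → v₁≢w₂ (sym e)
                   ; refl (inj₂ (inj₂ (inj₁ (refl , e)))) → v₂≢w₁ e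
                   ; refl (inj₂ (inj₂ (inj₂ (refl , e)))) → v₂≢w₁ (sym e) }
    ; ~-sym    = Sum.map (λ (e , ¬p , ¬q) → ~-sym e , ¬p ∘ SamePair-sym , ¬q ∘ SamePair-sym)
                         (Sum.map SamePair-sym SamePair-sym)
    ; _~?_     = λ x y →
        ((x ~? y) ×-dec ¬? (SamePair? x y v₁ v₂) ×-dec ¬? (SamePair? x y w₁ w₂))
        ⊎-dec SamePair? x y v₁ w₂ ⊎-dec SamePair? x y v₂ w₁
    }

  switchGraph-is2Switch :
    ∀ {v₁ v₂ w₁ w₂} (v₁≢w₂ : v₁ ≢ w₂) (v₂≢w₁ : v₂ ≢ w₁) →
    v₁ ~ v₂ → w₁ ~ w₂ → ¬ (v₁ ~ w₂) → ¬ (v₂ ~ w₁) →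
    Is2Switch G (switchGraph v₁ v₂ w₁ w₂ v₁≢w₂ v₂≢w₁) v₁ v₂ w₁ w₂
  switchGraph-is2Switch v₁≢w₂ v₂≢w₁ v₁~v₂ w₁~w₂ v₁≁w₂ v₂≁w₁ = record
    { v₁~v₂ = v₁~v₂
    ; w₁~w₂ = w₁~w₂
    ; v₁≢w₂ = v₁≢w₂
    ; v₂≢w₁ = v₂≢w₁
    ; v₁≁w₂ = v₁≁w₂
    ; v₂≁w₁ = v₂≁w₁
    ; edges = λ x y → mk⇔ id id
    }

-- Agreement of two graphs, and a switch that increases it.

Agree : ∀ {n} → Graph n → Graph n → Fin n → Fin n → Set
Agree G H x y = Graph._~_ G x y ⇔ Graph._~_ H x y

AgreeRow : ∀ {n} → Graph n → Graph n → Fin n → Set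
AgreeRow G H x = ∀ y → Agree G H x y

-- The invariant of two nested loops: `keep-rows` protects the finished rows, `keep-columns` the
-- finished entries of the current row `v`.
record Progress {n} (G H G′ H′ : Graph n) (v x : Fin n) : Set where
  field
    keep-rows    : ∀ w → AgreeRow G H w → AgreeRow G′ H′ w
    keep-columns : ∀ u → Agree G H v u → Agree G′ H′ v u
    repaired     : Agree G′ H′ v x

progress-sym : ∀ {n} {G H G′ H′ : Graph n} {v x} → Progress G H G′ H′ v x → Progress H G H′ G′ v x
progress-sym p = record
  { keep-rows    = λ w agree y → ⇔-sym (keep-rows w (⇔-sym ∘ agree) y)
  ; keep-columns = λ u agree → ⇔-sym (keep-columns u (⇔-sym agree))
  ; repaired     = ⇔-sym repaired
  }
  where open Progress p

module _ {n} (G H : Graph n) where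
  private
    module G = Graph G
    module H = Graph H

  -- Row `v` changes only at `x` and `y`, and both entries disagreed before. The repaired entry `u`
  -- is left open because a switch in the other graph is an instance with `x` and `y` exchanged.
  switch-towards :
    ∀ {v x y z} → v G.~ x → ¬ v H.~ x → ¬ v G.~ y → v H.~ y → z G.~ y → ¬ z G.~ x →
    x ≢ z → ¬ AgreeRow G H z → deg G v ≡ deg G z → deg G x ≡ deg G y →
    ∃[ G′ ] DegreeRestricted2Switch G G′ × (∀ {u} → u ≡ x ⊎ u ≡ y → Progress G H G′ H v u)
  switch-towards {v} {x} {y} {z} Gvx ¬Hvx ¬Gvy Hvy Gzy ¬Gzx x≢z ¬rowz deg₁ deg₂ =
    switchGraph G v x z y v≢y x≢z , (v , x , z , y , switch , deg₁ , deg₂) , λ at → record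
      { keep-rows    = λ w agree u → agree u ⇔-∘ unchanged-row switch
          -- All four touched rows disagreed beforehand: `v` and `x` at the entry `vx`, `y` at the
          -- entry `vy`, `z` by hypothesis.
          (λ { refl → ¬Hvx (Equivalence.to (agree x) Gvx) })
          (λ { refl → ¬Hvx (H.~-sym (Equivalence.to (agree v) (G.~-sym Gvx))) })
          (λ { refl → ¬rowz agree })
          (λ { refl → ¬Gvy (G.~-sym (Equivalence.from (agree v) (H.~-sym Hvy))) }) u
      ; keep-columns = λ u agree → agree ⇔-∘ unchanged-in-row-v₁ switch
          (λ { refl → ¬Hvx (Equivalence.to agree Gvx) })
          (λ { refl → ¬Gvy (Equivalence.from agree Hvy) })
      ; repaired     = repaired at
      }
    where
    v≢y : v ≢ y
    v≢y e = H.~-irrefl e Hvy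
    switch = switchGraph-is2Switch G v≢y x≢z Gvx Gzy ¬Gvy (¬Gzx ∘ G.~-sym)
    repaired : ∀ {u} → u ≡ x ⊎ u ≡ y → Agree (switchGraph G v x z y v≢y x≢z) H v u
    repaired (inj₁ refl) = mk⇔ (⊥-elim ∘ v₁≁′v₂ switch) (⊥-elim ∘ ¬Hvx)
    repaired (inj₂ refl) = mk⇔ (const Hvy) (const (v₁~′w₂ switch))

-- Finding the column `y` and the row `z` of a switch.

module _ {n} {G H : Graph n} (G≃H : G ≃ H) {v : Fin n} where
  private
    module G = Graph G
    module H = Graph H

  -- Among the vertices of degree `deg G x`, `v` has equally many neighbors in both graphs. As `x`
  -- is counted in `G` only, some `y` is counted in `H` only.
  find-column : ∀ {x} → v G.~ x → ¬ v H.~ x →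
                ∃[ y ] ¬ v G.~ y × v H.~ y × deg G x ≡ deg G y
  find-column {x} Gvx ¬Hvx with sum-≤⇒∃ (λ w → adj G v w * κ w) (λ w → adj H v w * κ w) x
                                  (ℕ.≤-reflexive (≃⇒nbrSum≡ G≃H v (λ d → 𝟙 (deg G x ℕ.≟ d)))) at-x
    where
    κ : Fin n → ℕ
    κ w = 𝟙 (deg G x ℕ.≟ deg G w)
    at-x : adj H v x * κ x < adj G v x * κ x
    at-x rewrite 𝟙-no (v H.~? x) ¬Hvx | 𝟙-yes (v G.~? x) Gvx
               | 𝟙-yes (deg G x ℕ.≟ deg G x) refl = s≤s z≤n
  ... | y , lt with v G.~? y | v H.~? y | deg G x ℕ.≟ deg G y
  -- Both terms are 0 or 1, so the strict inequality leaves just this case.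
  ...   | no ¬Gvy | yes Hvy | yes eq = y , ¬Gvy , Hvy , eq
  ...   | yes _   | yes _   | yes _  = contradiction lt (ℕ.<-irrefl refl)
  ...   | yes _   | no _    | yes _  = contradiction lt λ ()
  ...   | no _    | no _    | yes _  = contradiction lt λ ()
  ...   | a       | b       | no _   =
    contradiction (subst₂ _<_ (ℕ.*-zeroʳ (𝟙 a)) (ℕ.*-zeroʳ (𝟙 b)) lt) λ ()

  module _ {x y : Fin n} (Gvx : v G.~ x) (¬Hvx : ¬ v H.~ x) (¬Gvy : ¬ v G.~ y) (Hvy : v H.~ y)
           (deg≡ : deg G x ≡ deg G y) where
    private
      τ : Fin n → Fin n
      τ = transpose x y ⟨$⟩ʳ_

      κ : Fin n → ℕ
      κ z = 𝟙 (deg G v ℕ.≟ deg G z)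

      -- Up to transposing x and y in the rows of x, f counts z ~ y in G and z ~ x in H,
      -- while g counts z ~ y in H and z ~ x in G, for z of the same degree as v. The totals
      -- are equal and f < g at v, so g < f somewhere. The transposition makes f and g agree
      -- at x and at y.
      f g : Fin n → ℕ
      f z = adj G y z * κ z + adj H x (τ z) * κ z
      g z = adj H y z * κ z + adj G x (τ z) * κ z

      κx≡κy : κ x ≡ κ y
      κx≡κy = cong (λ d → 𝟙 (deg G v ℕ.≟ d)) deg≡

      -- As `x` and `y` have equal degrees, `κ` is invariant under `τ`, so the transposition only
      -- permutes the terms.
      transposed-row : ∀ K → sum (λ z → adj K x (τ z) * κ z) ≡ nbrSum K x κ
      transposed-row K = sum-transposed _ _ x y
        (cong₂ (λ w → adj K x w *_) (transpose-left x y) κx≡κy)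
        (cong₂ (λ w → adj K x w *_) (transpose-right x y) (sym κx≡κy))
        (λ k k≢x k≢y → cong (λ w → adj K x w * κ k) (transpose-other x y k≢x k≢y))

      sum-f≡sum-g : sum f ≡ sum g
      sum-f≡sum-g = begin
        sum f
          ≡⟨ ∑-distrib-+ (λ z → adj G y z * κ z) _ ⟩
        nbrSum G y κ + sum (λ z → adj H x (τ z) * κ z)
          ≡⟨ cong (nbrSum G y κ +_) (transposed-row H) ⟩
        nbrSum G y κ + nbrSum H x κ
          ≡⟨ cong₂ _+_ (≃⇒nbrSum≡ G≃H y φ) (sym (≃⇒nbrSum≡ G≃H x φ)) ⟩
        nbrSum H y κ + nbrSum G x κ
          ≡⟨ cong (nbrSum H y κ +_) (transposed-row G) ⟨
        nbrSum H y κ + sum (λ z → adj G x (τ z) * κ z)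
          ≡⟨ ∑-distrib-+ (λ z → adj H y z * κ z) _ ⟨
        sum g ∎
        where
        open ≡-Reasoning
        φ : ℕ → ℕ
        φ d = 𝟙 (deg G v ℕ.≟ d)

      fv<gv : f v < g v
      fv<gv
        -- `τ` fixes `v`, which is adjacent to `x` in `G` and to `y` in `H`. The other rewrites give
        -- `f v = 0` and `g v = 2`.
        rewrite transpose-other x y (λ e → G.~-irrefl e Gvx) (λ e → H.~-irrefl e Hvy)
              | 𝟙-yes (deg G v ℕ.≟ deg G v) refl
              | 𝟙-no (y G.~? v) (¬Gvy ∘ G.~-sym) | 𝟙-no (x H.~? v) (¬Hvx ∘ H.~-sym)
              | 𝟙-yes (y H.~? v) (H.~-sym Hvy) | 𝟙-yes (x G.~? v) (G.~-sym Gvx) = s≤s z≤n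

      -- The transposed terms read the entry `xy`, so both sides have the same two terms in opposite
      -- order. In `fy≡gy` all four entries are diagonal and vanish.
      fx≡gx : f x ≡ g x
      fx≡gx rewrite transpose-left x y | adj-sym G y x | adj-sym H y x =
        ℕ.+-comm (adj G x y * κ x) (adj H x y * κ x)

      fy≡gy : f y ≡ g y
      fy≡gy rewrite transpose-right x y
                  | 𝟙-no (x G.~? x) (G.~-irrefl refl) | 𝟙-no (y G.~? y) (G.~-irrefl refl)
                  | 𝟙-no (x H.~? x) (H.~-irrefl refl) | 𝟙-no (y H.~? y) (H.~-irrefl refl) = refl

      module _ {z : Fin n} (gz<fz : g z < f z) where

        fz≢gz : f z ≢ g z
        fz≢gz e = ℕ.<-irrefl (sym e) gz<fz

        z≢x : z ≢ x
        z≢x e = fz≢gz (subst (λ w → f w ≡ g w) (sym e) fx≡gx)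

        z≢y : z ≢ y
        z≢y e = fz≢gz (subst (λ w → f w ≡ g w) (sym e) fy≡gy)

        fz : f z ≡ (adj G z y + adj H z x) * κ z
        fz = trans
          (cong₂ (λ a b → a * κ z + b * κ z) (adj-sym G y z)
            (trans (cong (adj H x) (transpose-other x y z≢x z≢y)) (adj-sym H x z)))
          (sym (ℕ.*-distribʳ-+ (κ z) (adj G z y) (adj H z x)))

        gz : g z ≡ (adj H z y + adj G z x) * κ z
        gz = trans
          (cong₂ (λ a b → a * κ z + b * κ z) (adj-sym H y z)
            (trans (cong (adj G x) (transpose-other x y z≢x z≢y)) (adj-sym G x z)))
          (sym (ℕ.*-distribʳ-+ (κ z) (adj H z y) (adj G z x)))

        ¬agree-row : ¬ AgreeRow G H z
        ¬agree-row agree = fz≢gz (trans fz (trans (cong (_* κ z) (cong₂ _+_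
          (𝟙-cong (z G.~? y) (z H.~? y) (agree y))
          (sym (𝟙-cong (z G.~? x) (z H.~? x) (agree x))))) (sym gz)))

        -- Otherwise `κ z = 0`, and `f z` and `g z` both vanish.
        deg-z : deg G v ≡ deg G z
        deg-z = decidable-stable (deg G v ℕ.≟ deg G z) λ ≢ →
          fz≢gz (trans fz (trans (vanish (adj G z y + adj H z x) ≢)
            (sym (trans gz (vanish (adj H z y + adj G z x) ≢)))))
          where
          vanish : ∀ m → deg G v ≢ deg G z → m * κ z ≡ 0
          vanish m ≢ = trans (cong (m *_) (𝟙-no (deg G v ℕ.≟ deg G z) ≢)) (ℕ.*-zeroʳ m)

        -- If both alternatives fail, then `adj G z y ≤ adj G z x` and `adj H z x ≤ adj H z y`, and
        -- adding these gives `f z ≤ g z`.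
        switchable : z G.~ y × ¬ z G.~ x ⊎ z H.~ x × ¬ z H.~ y
        switchable with 𝟙-compare (z G.~? y) (z G.~? x) | 𝟙-compare (z H.~? x) (z H.~? y)
        ... | inj₁ p | _      = inj₁ p
        ... | _      | inj₁ q = inj₂ q
        ... | inj₂ a | inj₂ b = contradiction gz<fz (ℕ.≤⇒≯
          (subst₂ _≤_ (sym fz) (trans (cong (_* κ z) (ℕ.+-comm (adj G z x) _)) (sym gz))
            (ℕ.*-monoˡ-≤ (κ z) (ℕ.+-mono-≤ a b))))

    find-row : ∃[ z ] (z G.~ y × ¬ z G.~ x ⊎ z H.~ x × ¬ z H.~ y) ×
                      z ≢ x × z ≢ y × ¬ AgreeRow G H z × deg G v ≡ deg G z
    find-row with z , lt ← sum-≤⇒∃ g f v (ℕ.≤-reflexive (sym sum-f≡sum-g)) fv<gv =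
      z , switchable lt , z≢x lt , z≢y lt , ¬agree-row lt , deg-z lt

-- Repairing the adjacency matrices row by row.

record Approach {n} (G H : Graph n) (P : Graph n → Graph n → Set) : Set₁ where
  constructor approach
  field
    {G′ H′} : Graph n
    G↝G′    : Star DegreeRestricted2Switch G G′
    H↝H′    : Star DegreeRestricted2Switch H H′
    result  : P G′ H′

approach-swap : ∀ {n} {G H : Graph n} {P Q : Graph n → Graph n → Set} →
                (∀ {G′ H′} → P H′ G′ → Q G′ H′) → Approach H G P → Approach G H Q
approach-swap P⇒Q (approach s t p) = approach t s (P⇒Q p)

-- Switches preserve `_≃_`, so the pair of graphs reached is related again and `next` applies to it.
approach-then : ∀ {n} {G H : Graph n} {P Q : Graph n → Graph n → Set} →
                G ≃ H → Approach G H P → (∀ {G′ H′} → G′ ≃ H′ → P G′ H′ → Approach G′ H′ Q) →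
                Approach G H Q
approach-then G≃H (approach s t p) next
  with approach s′ t′ q ← next (≃-trans (≃-sym (switches⇒≃ s)) (≃-trans G≃H (switches⇒≃ t))) p
  = approach (s ◅◅ s′) (t ◅◅ t′) q

approach-map : ∀ {n} {G H : Graph n} {P Q : Graph n → Graph n → Set} →
               (∀ {G′ H′} → P G′ H′ → Q G′ H′) → Approach G H P → Approach G H Q
approach-map P⇒Q (approach s t p) = approach s t (P⇒Q p)

module _ {n} {G H : Graph n} (G≃H : G ≃ H) where
  private
    module G = Graph G
    module H = Graph H

  repair-by-row :
    ∀ {v x y} → v G.~ x → ¬ v H.~ x → ¬ v G.~ y → v H.~ y → deg G x ≡ deg G y →
    (∃[ z ] (z G.~ y × ¬ z G.~ x ⊎ z H.~ x × ¬ z H.~ y) ×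
            z ≢ x × z ≢ y × ¬ AgreeRow G H z × deg G v ≡ deg G z) →
    Approach G H (λ G′ H′ → Progress G H G′ H′ v x)
  repair-by-row Gvx ¬Hvx ¬Gvy Hvy deg-xy
    (z , inj₁ (Gzy , ¬Gzx) , z≢x , z≢y , ¬row , deg-vz) =
    let _ , s , p = switch-towards G H Gvx ¬Hvx ¬Gvy Hvy Gzy ¬Gzx (z≢x ∘ sym) ¬row deg-vz deg-xy
    in approach (s ◅ ε) ε (p (inj₁ refl))
  repair-by-row Gvx ¬Hvx ¬Gvy Hvy deg-xy
    (z , inj₂ (Hzx , ¬Hzy) , z≢x , z≢y , ¬row , deg-vz) =
    -- `H` plays the part of `G`, and `y` that of `x`: the edges `vy`, `zx` of `H` become `vx`,
    -- `zy`. Accordingly `inj₂` picks the entry `vx`.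
    let _ , s , p = switch-towards H G Hvy ¬Gvy ¬Hvx Gvx Hzx ¬Hzy (z≢y ∘ sym)
                      (λ row → ¬row (⇔-sym ∘ row)) (≃⇒deg-pair G≃H deg-vz)
                      (sym (≃⇒deg-pair G≃H deg-xy))
    in approach ε (s ◅ ε) (progress-sym (p (inj₂ refl)))

  repair-removed : ∀ {v x} → v G.~ x → ¬ v H.~ x →
                   Approach G H (λ G′ H′ → Progress G H G′ H′ v x)
  repair-removed Gvx ¬Hvx =
    let y , ¬Gvy , Hvy , deg-xy = find-column G≃H Gvx ¬Hvx
    in repair-by-row Gvx ¬Hvx ¬Gvy Hvy deg-xy (find-row G≃H Gvx ¬Hvx ¬Gvy Hvy deg-xy)

repair : ∀ {n} {G H : Graph n} → G ≃ H → ∀ v x → Approach G H (λ G′ H′ → Progress G H G′ H′ v x)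
repair {G = G} {H} G≃H v x with Graph._~?_ G v x | Graph._~?_ H v x
... | yes Gvx | no ¬Hvx = repair-removed G≃H Gvx ¬Hvx
... | no ¬Gvx | yes Hvx = approach-swap progress-sym (repair-removed (≃-sym G≃H) Hvx ¬Gvx)
... | yes Gvx | yes Hvx = approach ε ε record
  { keep-rows = λ _ → id ; keep-columns = λ _ → id ; repaired = mk⇔ (const Hvx) (const Gvx) }
... | no ¬Gvx | no ¬Hvx = approach ε ε record
  { keep-rows = λ _ → id ; keep-columns = λ _ → id
  ; repaired = mk⇔ (⊥-elim ∘ ¬Gvx) (⊥-elim ∘ ¬Hvx) }

-- One pass of either loop: the list holds what may be unfinished, and `P` and `Q` express agreement
-- before and after the graphs change.
all-but-tail : ∀ {A : Set} {P Q : A → Set} {x xs} → (∀ y → P y → Q y) → Q x →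
               (∀ y → P y ⊎ y ∈ x ∷ xs) → ∀ y → Q y ⊎ y ∈ xs
all-but-tail P⇒Q Qx cover y with cover y
... | inj₁ Py          = inj₁ (P⇒Q y Py)
... | inj₂ (here refl) = inj₁ Qx
... | inj₂ (there y∈)  = inj₂ y∈

-- `xs` contains every column where row `v` may still disagree. Each pass repairs its head, and
-- `keep-columns` guards the rest of the row.
repair-row : ∀ {n} {G H : Graph n} → G ≃ H → ∀ v xs → (∀ u → Agree G H v u ⊎ u ∈ xs) →
             Approach G H (λ G′ H′ → (∀ w → AgreeRow G H w → AgreeRow G′ H′ w) × AgreeRow G′ H′ v)
repair-row G≃H v []       agree = approach ε ε ((λ _ → id) , λ u → [ id , (λ ()) ]′ (agree u))
repair-row G≃H v (x ∷ xs) agree = approach-then G≃H (repair G≃H v x) λ G′≃H′ p →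
  approach-map (λ (rows , row) → (λ w → rows w ∘ Progress.keep-rows p w) , row)
    (repair-row G′≃H′ v xs (all-but-tail (Progress.keep-columns p) (Progress.repaired p) agree))

repair-rows : ∀ {n} {G H : Graph n} → G ≃ H → ∀ vs → (∀ w → AgreeRow G H w ⊎ w ∈ vs) →
              Approach G H _≈_
repair-rows G≃H []       agree = approach ε ε λ w → [ id , (λ ()) ]′ (agree w)
repair-rows G≃H (v ∷ vs) agree =
  approach-then G≃H (repair-row G≃H v (allFin _) (λ u → inj₂ (∈-allFin u)))
    λ G′≃H′ (rows , row) → repair-rows G′≃H′ vs (all-but-tail rows row agree)

-- The switches made in `H` are run backwards: the route goes from `G` to `G′`, across `G′ ≈ H′`,
-- and on to `H`.
approach⇒transforms : ∀ {n} {G H : Graph n} → Approach G H _≈_ → TransformsInto G H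
approach⇒transforms (approach G↝G′ H↝H′ G′≈H′)
  with K , G′↝K , K≈H ← switches-respˡ-≈ G′≈H′ (reverse switch-sym H↝H′)
  = K , G↝G′ ◅◅ G′↝K , K≈H

≃⇒transforms : ∀ {n} {G H : Graph n} → G ≃ H → TransformsInto G H
≃⇒transforms G≃H =
  approach⇒transforms (repair-rows G≃H (allFin _) (λ w → inj₂ (∈-allFin w)))

transforms⇒≃ : ∀ {n} {G H : Graph n} → TransformsInto G H → G ≃ H
transforms⇒≃ (_ , G↝K , K≈H) = ≃-trans (switches⇒≃ G↝K) (≈⇒≃ K≈H)

theorem1p1 : ∀ (n : ℕ) (G H : Graph n) → HasDiameter G 2 → HasDiameter H 2 →
    (N₂DL G ≡ N₂DL H) ⇔ TransformsInto G H
theorem1p1 n G H G₂ H₂ = mk⇔ (≃⇒transforms ∘ N₂DL≡⇒≃ G₂ H₂) (≃⇒N₂DL≡ G₂ H₂ ∘ transforms⇒≃)
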